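{- Let $d\ge 1$ be an integer. For every $N\in\mathbb{Z}_{\ge 0}$, $$g_d(N)=\sum_{k=1}^{d}(-1)^{k-1}\binom{d}{k}\binom{N+2d-k-1}{2d-k-1}.$$
   Context: Let $[d]=\{1,\dots,d\}$. A matrix $A\in\mathbb{R}^{d\times d}$ is a $G$-matrix of value $N\in\mathbb{R}_{\ge 0}$ if all its entries are nonnegative and $A_{1,\sigma(1)}+A_{2,\sigma(2)}+\cdots+A_{d,\sigma(d)}=N$ for every permutation $\sigma$ of $[d]$. For $N\in\mathbb{Z}_{\ge 0}$, $g_d(N)$ denotes the number of $d\times d$ $G$-matrices of value $N$ all of whose entries are integers. -}

module Defs where

open import Data.Nat.Base using (ℕ)
open import Data.Integer.Base using (ℤ; +_; 0ℤ; _≤_)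
open import Data.Integer.Properties using (+-0-commutativeMonoid)
open import Data.Fin.Permutation using (Permutation′; _⟨$⟩ʳ_)
open import Data.Product.Base using (Σ; proj₁)
open import Data.Vec.Functional using (Vector)
open import Data.Vec.Functional.Relation.Binary.Equality.Setoid using (≋-setoid)
open import Function.Bundles using (Inverse)
open import Level using (0ℓ)
open import Relation.Binary.Bundles using (Setoid)
open import Relation.Binary.PropositionalEquality using (_≡_; setoid)
open import Data.Fin.Base using (Fin)
import Relation.Binary.Construct.On as On

-- The sum syntax  ∑[ i < n ] f i  has i : Fin n, i.e. i runs from 0 to n - 1.
open import Algebra.Properties.CommutativeMonoid.Sum +-0-commutativeMonoid public
  using (sum-syntax)

Matrix : ℕ → Set
Matrix d = Vector (Vector ℤ d) d

-- Equality of matrices is entrywise.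
matrixSetoid : ℕ → Setoid 0ℓ 0ℓ
matrixSetoid d = ≋-setoid (≋-setoid (setoid ℤ) d) d

record IsGMatrix (d N : ℕ) (A : Matrix d) : Set where
  field
    nonneg : ∀ i j → 0ℤ ≤ A i j
    value  : (σ : Permutation′ d) → ∑[ i < d ] A i (σ ⟨$⟩ʳ i) ≡ + N

-- Two elements are identified when their underlying matrices are equal
-- entrywise; the proofs of IsGMatrix are ignored, so each G-matrix is
-- counted once.
GMatrices : ℕ → ℕ → Setoid 0ℓ 0ℓ
GMatrices d N = On.setoid {B = Σ (Matrix d) (IsGMatrix d N)} (matrixSetoid d) proj₁

HasCardinality : Setoid 0ℓ 0ℓ → ℕ → Set
HasCardinality S n = Inverse (setoid (Fin n)) S

{-# OPTIONS --safe #-}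

-- A G-matrix has the form A i j = r i + c j with natural numbers r i and c j,
-- and the pair (r , c) is unique once some c j is required to vanish; the
-- value of A is then the sum of all entries of r and c.  Deciding in turn
-- whether each coordinate is zero or positive gives a recursion for the number
-- of such pairs, which Pascal's rule turns into the alternating sum.
module Submission where

open import Defs
open import Data.Nat.Base using (ℕ; zero; suc; _≥_; _+_; _*_; _∸_; _≤_; _<_; s≤s; z≤n)
open import Data.Nat.Properties as ℕₚ using (suc-injective)
open import Data.Nat.Combinatorics using (_C_; nCn≡1; k>n⇒nCk≡0; nCk+nC[k+1]≡[n+1]C[k+1])
open import Data.Fin.Base using (Fin; zero; suc; toℕ; fromℕ; inject₁; punchIn)
open import Data.Fin.Patterns using (0F)
open import Data.Fin.Permutation using (Permutation′; _⟨$⟩ʳ_; transpose; _∘ₚ_; id)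
open import Data.Fin.Properties as Finₚ
  using (+↔⊎; toℕ<n; toℕ-fromℕ; toℕ-inject₁; punchInᵢ≢i)
open import Data.Integer.Base as ℤ using (ℤ; +_; -1ℤ; 0ℤ; 1ℤ; ∣_∣; +≤+)
open import Data.Integer.Properties as ℤₚ using (+-injective; 0≤i⇒+∣i∣≡i)
open import Data.Integer.Tactic.RingSolver using (solve-∀)
import Data.Nat.Tactic.RingSolver as ℕSolver
open import Data.Product.Base using (Σ; ∃-syntax; _×_; _,_; proj₁; proj₂)
open import Data.Sum.Base using (_⊎_; inj₁; inj₂)
open import Data.Sum.Function.Propositional using (_⊎-↔_)
open import Data.Empty using (⊥)
open import Data.Unit.Base using (⊤; tt)
open import Data.Vec.Base using (Vec; []; _∷_; sum; lookup; tabulate)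
open import Data.Vec.Properties using (lookup∘tabulate; tabulate∘lookup; tabulate-cong)
open import Data.Vec.Functional using (Vector)
open import Function.Base using (_∘_)
open import Function.Bundles using (Inverse; _↔_; mk↔ₛ′)
open import Function.Construct.Composition using (inverse)
open import Function.Properties.Bijection using (Bijection⇒Inverse)
open import Function.Properties.Inverse using (↔-trans)
open import Relation.Binary.PropositionalEquality
open import Relation.Nullary.Decidable using (yes; no; dec-true; dec-false)

open import Algebra.Bundles using (AbelianGroup)
open import Algebra.Properties.Semiring.Sum ℤₚ.+-*-semiring
  using (sum-cong-≗; sum-init-last; sum-remove; ∑-distrib-+; ∑-permute; *-distribˡ-sum)
  renaming (sum to ∑)

open import Algebra.Properties.Group (AbelianGroup.group ℤₚ.+-0-abelianGroup) using (∙-cancelʳ)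

private
  variable
    n p q N : ℕ

-- Weak compositions

Composition : ℕ → ℕ → Set
Composition n N = Σ (Vec ℕ n) λ v → sum v ≡ N

compositionCount : ℕ → ℕ → ℕ
compositionCount zero    zero    = 1
compositionCount zero    (suc N) = 0
compositionCount (suc n) zero    = compositionCount n zero
compositionCount (suc n) (suc N) = compositionCount n (suc N) + compositionCount (suc n) N

composition-suc-zero : Composition n 0 ↔ Composition (suc n) 0
composition-suc-zero = mk↔ₛ′
  (λ { (v , e) → 0 ∷ v , e })
  (λ { (0 ∷ v , e) → v , e })
  (λ { (0 ∷ v , e) → refl })
  (λ { (_ , _) → refl })

composition-suc-suc : (Composition n (suc N) ⊎ Composition (suc n) N) ↔ Composition (suc n) (suc N)
composition-suc-suc = mk↔ₛ′
  (λ { (inj₁ (v , e)) → 0 ∷ v , e ; (inj₂ (x ∷ v , e)) → suc x ∷ v , cong suc e })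
  (λ { (0 ∷ v , e) → inj₁ (v , e) ; (suc x ∷ v , e) → inj₂ (x ∷ v , suc-injective e) })
  (λ { (0 ∷ v , e) → refl ; (suc x ∷ v , refl) → refl })
  (λ { (inj₁ (_ , _)) → refl ; (inj₂ (x ∷ v , refl)) → refl })

compositions : ∀ n N → Fin (compositionCount n N) ↔ Composition n N
compositions zero    zero    = mk↔ₛ′ (λ _ → [] , refl) (λ _ → zero) (λ { ([] , refl) → refl }) (λ { zero → refl })
compositions zero    (suc N) = mk↔ₛ′ (λ ()) (λ { ([] , ()) }) (λ { ([] , ()) }) (λ ())
compositions (suc n) zero    = ↔-trans (compositions n zero) composition-suc-zero
compositions (suc n) (suc N) = ↔-trans +↔⊎
  (↔-trans (compositions n (suc N) ⊎-↔ compositions (suc n) N) composition-suc-suc)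

compositionCount-zero : ∀ n → compositionCount n 0 ≡ 1
compositionCount-zero zero    = refl
compositionCount-zero (suc n) = compositionCount-zero n

-- Stars and bars. The two summands of the recursion are neighbours in one row of Pascal's triangle.
compositionCount-suc : ∀ n N → compositionCount (suc n) N ≡ (N + n) C n
compositionCount-suc zero    zero    = refl
compositionCount-suc zero    (suc N) = compositionCount-suc zero N
compositionCount-suc (suc n) zero    = trans (compositionCount-zero n) (sym (nCn≡1 (suc n)))
compositionCount-suc (suc n) (suc N) = begin
  compositionCount (suc n) (suc N) + compositionCount (2 + n) N
    ≡⟨ cong₂ _+_ (compositionCount-suc n (suc N)) (compositionCount-suc (suc n) N) ⟩
  suc (N + n) C n + (N + suc n) C suc n
    ≡⟨ cong (λ k → k C n + (N + suc n) C suc n) (ℕₚ.+-suc N n) ⟨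
  (N + suc n) C n + (N + suc n) C suc n
    ≡⟨ nCk+nC[k+1]≡[n+1]C[k+1] (N + suc n) n ⟩
  suc (N + suc n) C suc n ∎
  where open ≡-Reasoning

-- Normalised pairs

-- Stopping at the first zero makes the witness unique even when several entries vanish, so each
-- pair is counted once.
HasZero : Vec ℕ n → Set
HasZero []          = ⊥
HasZero (zero  ∷ v) = ⊤
HasZero (suc _ ∷ v) = HasZero v

HasZero-irrelevant : (v : Vec ℕ n) (z z′ : HasZero v) → z ≡ z′
HasZero-irrelevant (zero  ∷ v) _ _  = refl
HasZero-irrelevant (suc _ ∷ v) z z′ = HasZero-irrelevant v z z′

HasZero⇒lookup : (v : Vec ℕ n) → HasZero v → ∃[ j ] lookup v j ≡ 0
HasZero⇒lookup (zero  ∷ v) _ = zero , refl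
HasZero⇒lookup (suc _ ∷ v) z with HasZero⇒lookup v z
... | j , e = suc j , e

lookup⇒HasZero : (v : Vec ℕ n) (j : Fin n) → lookup v j ≡ 0 → HasZero v
lookup⇒HasZero (zero  ∷ v) _       _ = tt
lookup⇒HasZero (suc _ ∷ v) (suc j) e = lookup⇒HasZero v j e

-- A constant can be shifted between `r` and `c` without changing the sums `r i + c j`; a zero in
-- `c` fixes the shift. The two lengths are independent so that coordinates can be treated one at a
-- time.
NormalPair : ℕ → ℕ → ℕ → Set
NormalPair p q N =
  Σ (Vec ℕ p × Vec ℕ q) λ (r , c) → HasZero c × sum r + sum c ≡ N

NormalPair-≡ : {x y : NormalPair p q N} → proj₁ x ≡ proj₁ y → x ≡ y
NormalPair-≡ {x = (_ , c) , z , e} {y = _ , z′ , e′} refl =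
  cong (_ ,_) (cong₂ _,_ (HasZero-irrelevant c z z′) (ℕₚ.≡-irrelevant e e′))

-- The entries of `r` come first, since they do not affect `HasZero`. Once `r` is empty, a zero at
-- the head of `c` leaves the other `q` entries free, which is where `compositionCount` enters.
normalPairCount : ℕ → ℕ → ℕ → ℕ
normalPairCount zero    zero    N       = 0
normalPairCount zero    (suc q) zero    = compositionCount q 0
normalPairCount zero    (suc q) (suc N) = compositionCount q (suc N) + normalPairCount 1 q N
normalPairCount (suc p) q       zero    = normalPairCount p q zero
normalPairCount (suc p) q       (suc N) = normalPairCount p q (suc N) + normalPairCount (suc p) q N

normalPair-zero-zero : Composition q 0 ↔ NormalPair 0 (suc q) 0
normalPair-zero-zero = mk↔ₛ′
  (λ { (v , e) → ([] , 0 ∷ v) , tt , e })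
  (λ { (([] , 0 ∷ v) , _ , e) → v , e })
  (λ { (([] , 0 ∷ v) , _ , e) → refl })
  (λ { (_ , _) → refl })

-- A positive first entry of c no longer matters for HasZero c, so its
-- predecessor is moved over to r.
normalPair-zero-suc : (Composition q (suc N) ⊎ NormalPair 1 q N) ↔ NormalPair 0 (suc q) (suc N)
normalPair-zero-suc {q} {N} = mk↔ₛ′ to from to∘from from∘to
  where
  move : ∀ x (c : Vec ℕ q) → x + 0 + sum c ≡ x + sum c
  move x c = cong (_+ sum c) (ℕₚ.+-identityʳ x)

  to : Composition q (suc N) ⊎ NormalPair 1 q N → NormalPair 0 (suc q) (suc N)
  to (inj₁ (v , e))                = ([] , 0 ∷ v) , tt , e
  to (inj₂ ((x ∷ [] , c) , z , e)) = ([] , suc x ∷ c) , z , cong suc (trans (sym (move x c)) e)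

  from : NormalPair 0 (suc q) (suc N) → Composition q (suc N) ⊎ NormalPair 1 q N
  from (([] , zero  ∷ c) , _ , e) = inj₁ (c , e)
  from (([] , suc x ∷ c) , z , e) = inj₂ ((x ∷ [] , c) , z , trans (move x c) (suc-injective e))

  to∘from : ∀ y → to (from y) ≡ y
  to∘from (([] , zero  ∷ c) , _) = refl
  to∘from (([] , suc x ∷ c) , _) = NormalPair-≡ refl

  from∘to : ∀ x → from (to x) ≡ x
  from∘to (inj₁ (_ , _))            = refl
  from∘to (inj₂ ((x ∷ [] , c) , _)) = cong inj₂ (NormalPair-≡ refl)

normalPair-suc-zero : NormalPair p q 0 ↔ NormalPair (suc p) q 0
normalPair-suc-zero = mk↔ₛ′
  (λ { ((r , c) , z , e) → (0 ∷ r , c) , z , e })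
  (λ { ((0 ∷ r , c) , z , e) → (r , c) , z , e })
  (λ { ((0 ∷ r , c) , z , e) → refl })
  (λ { ((_ , _) , _ , _) → refl })

normalPair-suc-suc : (NormalPair p q (suc N) ⊎ NormalPair (suc p) q N) ↔ NormalPair (suc p) q (suc N)
normalPair-suc-suc = mk↔ₛ′
  (λ { (inj₁ ((r , c) , z , e)) → (0 ∷ r , c) , z , e
     ; (inj₂ ((x ∷ r , c) , z , e)) → (suc x ∷ r , c) , z , cong suc e })
  (λ { ((0 ∷ r , c) , z , e) → inj₁ ((r , c) , z , e)
     ; ((suc x ∷ r , c) , z , e) → inj₂ ((x ∷ r , c) , z , suc-injective e) })
  (λ { ((0 ∷ r , c) , z , e) → refl ; ((suc x ∷ r , c) , z , refl) → refl })
  (λ { (inj₁ ((_ , _) , _ , _)) → refl ; (inj₂ ((x ∷ r , c) , z , refl)) → refl })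

normalPairs : ∀ p q N → Fin (normalPairCount p q N) ↔ NormalPair p q N
normalPairs zero    zero    N       =
  mk↔ₛ′ (λ ()) (λ { ((_ , []) , () , _) }) (λ { ((_ , []) , () , _) }) (λ ())
normalPairs zero    (suc q) zero    = ↔-trans (compositions q 0) normalPair-zero-zero
normalPairs zero    (suc q) (suc N) = ↔-trans +↔⊎
  (↔-trans (compositions q (suc N) ⊎-↔ normalPairs 1 q N) normalPair-zero-suc)
normalPairs (suc p) q       zero    = ↔-trans (normalPairs p q zero) normalPair-suc-zero
normalPairs (suc p) q       (suc N) = ↔-trans +↔⊎
  (↔-trans (normalPairs p q (suc N) ⊎-↔ normalPairs (suc p) q N) normalPair-suc-suc)

-- Alternating binomial sums

-- The index `i` stands for `k - 1`: this is the shape of inclusion-exclusion over the nonempty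
-- subsets of `q` items, with `k` the size of the subset.
alternatingSum : ℕ → (ℕ → ℤ) → ℤ
alternatingSum q f =
  ∑[ i < q ] ((-1ℤ ℤ.^ toℕ i) ℤ.* (+ (q C suc (toℕ i))) ℤ.* f (toℕ i))

-- The bound `i < q` is handed to the pointwise hypothesis because some identities between truncated
-- differences used later hold only in that range.
alternatingSum-cong : ∀ q {f g : ℕ → ℤ} → (∀ i → i < q → f i ≡ g i) →
                      alternatingSum q f ≡ alternatingSum q g
alternatingSum-cong q f≡g = sum-cong-≗ {q} λ i →
  cong ((-1ℤ ℤ.^ toℕ i) ℤ.* (+ (q C suc (toℕ i))) ℤ.*_) (f≡g (toℕ i) (toℕ<n i))

alternatingSum-+ : ∀ q (f g : ℕ → ℤ) →
  alternatingSum q (λ i → f i ℤ.+ g i) ≡ alternatingSum q f ℤ.+ alternatingSum q g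
alternatingSum-+ q f g = trans
  (sum-cong-≗ {q} λ i → ℤₚ.*-distribˡ-+ ((-1ℤ ℤ.^ toℕ i) ℤ.* (+ (q C suc (toℕ i)))) (f (toℕ i)) (g (toℕ i)))
  (∑-distrib-+ {q} _ _)

-- Pascal's rule splits `suc q C suc i` into `q C i` and `q C suc i`. The second part gives the sum
-- for `q`; the first gives `f 0` and, after an index shift that flips the sign, the sum for
-- `f ∘ suc`.
alternatingSum-suc : ∀ q (f : ℕ → ℤ) →
  alternatingSum (suc q) f ≡ f 0 ℤ.+ (alternatingSum q f ℤ.- alternatingSum q (f ∘ suc))
alternatingSum-suc q f = begin
  alternatingSum (suc q) f
    ≡⟨ sum-cong-≗ {suc q} (λ i → pascal (toℕ i)) ⟩
  ∑[ i < suc q ] (low (toℕ i) ℤ.+ high (toℕ i))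
    ≡⟨ ∑-distrib-+ {suc q} (low ∘ toℕ) (high ∘ toℕ) ⟩
  ∑[ i < suc q ] low (toℕ i) ℤ.+ ∑[ i < suc q ] high (toℕ i)
    ≡⟨ cong₂ ℤ._+_ low-sum high-sum ⟩
  (f 0 ℤ.+ -1ℤ ℤ.* alternatingSum q (f ∘ suc)) ℤ.+ alternatingSum q f
    ≡⟨ rearrange (f 0) _ _ ⟩
  f 0 ℤ.+ (alternatingSum q f ℤ.- alternatingSum q (f ∘ suc)) ∎
  where
  open ≡-Reasoning

  low high : ℕ → ℤ
  low  i = (-1ℤ ℤ.^ i) ℤ.* (+ (q C i)) ℤ.* f i
  high i = (-1ℤ ℤ.^ i) ℤ.* (+ (q C suc i)) ℤ.* f i

  distrib : ∀ s a b x → s ℤ.* (a ℤ.+ b) ℤ.* x ≡ s ℤ.* a ℤ.* x ℤ.+ s ℤ.* b ℤ.* x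
  distrib = solve-∀

  rearrange : ∀ x a b → (x ℤ.+ -1ℤ ℤ.* a) ℤ.+ b ≡ x ℤ.+ (b ℤ.- a)
  rearrange = solve-∀

  pull : ∀ s a x → (-1ℤ ℤ.* s) ℤ.* a ℤ.* x ≡ -1ℤ ℤ.* (s ℤ.* a ℤ.* x)
  pull = solve-∀

  one : ∀ x → 1ℤ ℤ.* 1ℤ ℤ.* x ≡ x
  one = solve-∀

  pascal : ∀ i → (-1ℤ ℤ.^ i) ℤ.* (+ (suc q C suc i)) ℤ.* f i ≡ low i ℤ.+ high i
  pascal i = trans
    (cong (λ b → (-1ℤ ℤ.^ i) ℤ.* (+ b) ℤ.* f i) (sym (nCk+nC[k+1]≡[n+1]C[k+1] q i)))
    (distrib (-1ℤ ℤ.^ i) (+ (q C i)) (+ (q C suc i)) (f i))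

  low-sum : ∑[ i < suc q ] low (toℕ i) ≡ f 0 ℤ.+ -1ℤ ℤ.* alternatingSum q (f ∘ suc)
  low-sum = cong₂ ℤ._+_ (one (f 0)) (trans
    (sum-cong-≗ {q} λ i → pull (-1ℤ ℤ.^ toℕ i) (+ (q C suc (toℕ i))) (f (suc (toℕ i))))
    (sym (*-distribˡ-sum {q} -1ℤ _)))

  -- The sum over `suc q` indices has one term more than `alternatingSum q`; it vanishes because
  -- `q C suc q` is zero.
  high-last : high q ≡ 0ℤ
  high-last = trans
    (cong (λ b → (-1ℤ ℤ.^ q) ℤ.* (+ b) ℤ.* f q) (k>n⇒nCk≡0 (ℕₚ.n<1+n q)))
    (cong (ℤ._* f q) (ℤₚ.*-zeroʳ (-1ℤ ℤ.^ q)))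

  high-sum : ∑[ i < suc q ] high (toℕ i) ≡ alternatingSum q f
  high-sum = begin
    ∑[ i < suc q ] high (toℕ i)
      ≡⟨ sum-init-last {q} (high ∘ toℕ) ⟩
    ∑[ i < q ] high (toℕ (inject₁ i)) ℤ.+ high (toℕ (fromℕ q))
      ≡⟨ cong₂ ℤ._+_ (sum-cong-≗ {q} (cong high ∘ toℕ-inject₁))
                     (trans (cong high (toℕ-fromℕ q)) high-last) ⟩
    alternatingSum q f ℤ.+ 0ℤ
      ≡⟨ ℤₚ.+-identityʳ _ ⟩
    alternatingSum q f ∎

-- Inclusion-exclusion over the entries of `c` required to vanish: with `suc i` of them fixed at
-- zero, the other entries form a weak composition of length `p + q ∸ suc i`. The proof checks this
-- through the recursion of `normalPairCount`.
normalPairCount-alternatingSum : ∀ p q N →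
  + normalPairCount p q N ≡ alternatingSum q (λ i → + compositionCount (p + q ∸ suc i) N)
normalPairCount-alternatingSum zero zero N = refl
normalPairCount-alternatingSum zero (suc q) zero = begin
  + compositionCount q 0
    ≡⟨ cancel (+ compositionCount q 0) (alternatingSum q count) ⟩
  + compositionCount q 0 ℤ.+ (alternatingSum q count ℤ.- alternatingSum q count)
    -- At total 0 every composition count is 1, so shifting the index changes nothing.
    ≡⟨ cong (λ s → + compositionCount q 0 ℤ.+ (alternatingSum q count ℤ.- s))
            (alternatingSum-cong q λ i _ → cong +_
              (trans (compositionCount-zero (q ∸ i)) (sym (compositionCount-zero (q ∸ suc i))))) ⟩
  + compositionCount q 0 ℤ.+ (alternatingSum q count ℤ.- alternatingSum q (count ∘ suc))
    ≡⟨ alternatingSum-suc q count ⟨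
  alternatingSum (suc q) count ∎
  where
  open ≡-Reasoning
  count : ℕ → ℤ
  count i = + compositionCount (q ∸ i) 0
  cancel : ∀ x a → x ≡ x ℤ.+ (a ℤ.- a)
  cancel = solve-∀
normalPairCount-alternatingSum zero (suc q) (suc N) = begin
  + compositionCount q (suc N) ℤ.+ + normalPairCount 1 q N
    -- For `p = 1` the length `1 + q ∸ suc i` computes to `q ∸ i`, as in `count′`.
    ≡⟨ cong (λ s → + compositionCount q (suc N) ℤ.+ s) (normalPairCount-alternatingSum 1 q N) ⟩
  + compositionCount q (suc N) ℤ.+ alternatingSum q count′
    ≡⟨ cancel (+ compositionCount q (suc N)) (alternatingSum q (count ∘ suc)) (alternatingSum q count′) ⟩
  + compositionCount q (suc N) ℤ.+
    ((alternatingSum q (count ∘ suc) ℤ.+ alternatingSum q count′) ℤ.- alternatingSum q (count ∘ suc))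
    ≡⟨ cong (λ s → + compositionCount q (suc N) ℤ.+ (s ℤ.- alternatingSum q (count ∘ suc)))
            (sym (trans (alternatingSum-cong q step) (alternatingSum-+ q (count ∘ suc) count′))) ⟩
  + compositionCount q (suc N) ℤ.+ (alternatingSum q count ℤ.- alternatingSum q (count ∘ suc))
    ≡⟨ alternatingSum-suc q count ⟨
  alternatingSum (suc q) count ∎
  where
  open ≡-Reasoning
  count count′ : ℕ → ℤ
  count  i = + compositionCount (q ∸ i) (suc N)
  count′ i = + compositionCount (q ∸ i) N
  cancel : ∀ x a b → x ℤ.+ b ≡ x ℤ.+ ((a ℤ.+ b) ℤ.- a)
  cancel = solve-∀
  step : ∀ i → i < q → count i ≡ count (suc i) ℤ.+ count′ i
  -- For `i < q` the length `q ∸ i` is a successor, which lets the recursion of `compositionCount`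
  -- unfold.
  step i i<q rewrite ℕₚ.+-∸-assoc 1 i<q = refl
normalPairCount-alternatingSum (suc p) q zero = trans
  (normalPairCount-alternatingSum p q zero)
  (alternatingSum-cong q λ i _ → cong +_
    (trans (compositionCount-zero (p + q ∸ suc i)) (sym (compositionCount-zero (p + q ∸ i)))))
normalPairCount-alternatingSum (suc p) q (suc N) = begin
  + normalPairCount p q (suc N) ℤ.+ + normalPairCount (suc p) q N
    ≡⟨ cong₂ ℤ._+_ (normalPairCount-alternatingSum p q (suc N)) (normalPairCount-alternatingSum (suc p) q N) ⟩
  alternatingSum q (count ∘ suc) ℤ.+ alternatingSum q count′
    ≡⟨ alternatingSum-+ q (count ∘ suc) count′ ⟨
  alternatingSum q (λ i → count (suc i) ℤ.+ count′ i)
    ≡⟨ alternatingSum-cong q step ⟨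
  alternatingSum q count ∎
  where
  open ≡-Reasoning
  count count′ : ℕ → ℤ
  count  i = + compositionCount (p + q ∸ i) (suc N)
  count′ i = + compositionCount (p + q ∸ i) N
  step : ∀ i → i < q → count i ≡ count (suc i) ℤ.+ count′ i
  step i i<q rewrite ℕₚ.+-∸-assoc 1 (ℕₚ.≤-trans i<q (ℕₚ.m≤n+m q p)) = refl

-- Decomposing G-matrices

∑-lookup : (v : Vec ℕ n) → ∑[ i < n ] (+ lookup v i) ≡ + sum v
∑-lookup []      = refl
∑-lookup (x ∷ v) = cong (λ s → + x ℤ.+ s) (∑-lookup v)

sumMatrix : Vec ℕ n → Vec ℕ n → Matrix n
sumMatrix r c i j = + (lookup r i + lookup c j)

sumMatrix-value : (r c : Vec ℕ n) (σ : Permutation′ n) →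
  ∑[ i < n ] sumMatrix r c i (σ ⟨$⟩ʳ i) ≡ + (sum r + sum c)
sumMatrix-value {n} r c σ = begin
  ∑[ i < n ] (+ lookup r i ℤ.+ + lookup c (σ ⟨$⟩ʳ i))
    ≡⟨ ∑-distrib-+ {n} (λ i → + lookup r i) (λ i → + lookup c (σ ⟨$⟩ʳ i)) ⟩
  ∑[ i < n ] (+ lookup r i) ℤ.+ ∑[ i < n ] (+ lookup c (σ ⟨$⟩ʳ i))
    ≡⟨ cong₂ ℤ._+_ (∑-lookup r) (trans (sym (∑-permute (λ i → + lookup c i) σ)) (∑-lookup c)) ⟩
  + sum r ℤ.+ + sum c ∎
  where open ≡-Reasoning

sumMatrix-isGMatrix : (r c : Vec ℕ n) → sum r + sum c ≡ N → IsGMatrix n N (sumMatrix r c)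
sumMatrix-isGMatrix r c e = record
  { nonneg = λ _ _ → +≤+ z≤n
  ; value  = λ σ → trans (sumMatrix-value r c σ) (cong +_ e)
  }

lookup-ext : {v w : Vec ℕ n} → (∀ i → lookup v i ≡ lookup w i) → v ≡ w
lookup-ext {v = v} {w} eq =
  trans (sym (tabulate∘lookup v)) (trans (tabulate-cong eq) (tabulate∘lookup w))

-- In a column where `c` vanishes the matrix entries are those of `r`, hence at least those of `r′`.
-- By symmetry `r` and `r′` agree, and row 0 then determines `c`.
sumMatrix-injective : (r c r′ c′ : Vec ℕ (suc n)) → HasZero c → HasZero c′ →
  (∀ i j → sumMatrix r c i j ≡ sumMatrix r′ c′ i j) → r ≡ r′ × c ≡ c′
sumMatrix-injective {n} r c r′ c′ z z′ eq = r≡r′ , lookup-ext λ j →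
  ℕₚ.+-cancelˡ-≡ (lookup r 0F) _ _
    (trans (eqℕ 0F j) (cong (λ v → lookup v 0F + lookup c′ j) (sym r≡r′)))
  where
  eqℕ : ∀ i j → lookup r i + lookup c j ≡ lookup r′ i + lookup c′ j
  eqℕ i j = +-injective (eq i j)

  -- Four fresh vectors allow the bound to be applied in both directions.
  bound : (s d s′ d′ : Vec ℕ (suc n)) → HasZero d →
    (∀ i j → lookup s i + lookup d j ≡ lookup s′ i + lookup d′ j) → ∀ i → lookup s′ i ≤ lookup s i
  bound s d s′ d′ zd h i with HasZero⇒lookup d zd
  ... | j , dj≡0 = begin
    lookup s′ i               ≤⟨ ℕₚ.m≤m+n _ _ ⟩
    lookup s′ i + lookup d′ j ≡⟨ h i j ⟨
    lookup s i + lookup d j   ≡⟨ cong (λ x → lookup s i + x) dj≡0 ⟩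
    lookup s i + 0            ≡⟨ ℕₚ.+-identityʳ _ ⟩
    lookup s i ∎
    where open ℕₚ.≤-Reasoning

  r≡r′ : r ≡ r′
  r≡r′ = lookup-ext λ i →
    ℕₚ.≤-antisym (bound r′ c′ r c z′ (λ i j → sym (eqℕ i j)) i) (bound r c r′ c′ z eqℕ i)

-- The remaining terms coincide and cancel from the equal totals; `punchIn i` runs through the tail
-- indices other than `i`.
∑-agree-off-pair : (i : Fin n) (f g : Vector ℤ (suc n)) →
  (∀ k → k ≢ i → f (suc k) ≡ g (suc k)) → ∑ f ≡ ∑ g →
  f 0F ℤ.+ f (suc i) ≡ g 0F ℤ.+ g (suc i)
∑-agree-off-pair {suc n} i f g agree ∑f≡∑g = ∙-cancelʳ (rest f) _ _ (begin
  f 0F ℤ.+ f (suc i) ℤ.+ rest f ≡⟨ split f ⟨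
  ∑ f                           ≡⟨ ∑f≡∑g ⟩
  ∑ g                           ≡⟨ split g ⟩
  g 0F ℤ.+ g (suc i) ℤ.+ rest g ≡⟨ cong (λ s → g 0F ℤ.+ g (suc i) ℤ.+ s)
                                        (sum-cong-≗ {n} λ k → agree (punchIn i k) (punchInᵢ≢i i k)) ⟨
  g 0F ℤ.+ g (suc i) ℤ.+ rest f ∎)
  where
  open ≡-Reasoning
  rest : Vector ℤ (2 + n) → ℤ
  rest h = ∑[ k < n ] h (suc (punchIn i k))
  split : ∀ h → ∑ h ≡ h 0F ℤ.+ h (suc i) ℤ.+ rest h
  split h = trans (cong (λ s → h 0F ℤ.+ s) (sum-remove {n} {i} (h ∘ suc))) (sym (ℤₚ.+-assoc (h 0F) _ _))

transpose-matchˡ : (i j : Fin n) → transpose i j ⟨$⟩ʳ i ≡ j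
transpose-matchˡ i j rewrite dec-true (i Finₚ.≟ i) refl = refl

transpose-matchʳ : (i j : Fin n) → transpose i j ⟨$⟩ʳ j ≡ i
transpose-matchʳ i j with j Finₚ.≟ i
... | yes j≡i = j≡i
... | no _ rewrite dec-true (j Finₚ.≟ j) refl = refl

transpose-mismatch : {i j k : Fin n} → k ≢ i → k ≢ j → transpose i j ⟨$⟩ʳ k ≡ k
transpose-mismatch {i = i} {j} {k} k≢i k≢j
  rewrite dec-false (k Finₚ.≟ i) k≢i | dec-false (k Finₚ.≟ j) k≢j = refl

module _ {A : Matrix (suc n)} (isG : IsGMatrix (suc n) N A) where
  open IsGMatrix isG

  -- Compare the permutation swapping suc i with suc j to its precomposition
  -- with the swap of 0 and suc i: they differ only in the rows 0 and suc i.
  exchange-suc : ∀ i j → A 0F 0F ℤ.+ A (suc i) (suc j) ≡ A 0F (suc j) ℤ.+ A (suc i) 0F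
  exchange-suc i j = begin
    A 0F 0F ℤ.+ A (suc i) (suc j)
      -- `σ` fixes 0 by computation, so only the column in row `suc i` is rewritten. For `i = j` it
      -- acts as the identity, and no separate case arises.
      ≡⟨ cong (λ k → A 0F 0F ℤ.+ A (suc i) k) (transpose-matchˡ (suc i) (suc j)) ⟨
    A 0F (σ ⟨$⟩ʳ 0F) ℤ.+ A (suc i) (σ ⟨$⟩ʳ suc i)
      ≡⟨ ∑-agree-off-pair i (λ k → A k (σ ⟨$⟩ʳ k)) (λ k → A k (τ ∘ₚ σ ⟨$⟩ʳ k))
           (λ k k≢i → cong (λ l → A (suc k) (σ ⟨$⟩ʳ l))
             (sym (transpose-mismatch {i = 0F} {suc i} (λ ()) (k≢i ∘ Finₚ.suc-injective))))
           (trans (value σ) (sym (value (τ ∘ₚ σ)))) ⟩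
    A 0F (σ ⟨$⟩ʳ suc i) ℤ.+ A (suc i) (σ ⟨$⟩ʳ (τ ⟨$⟩ʳ suc i))
      ≡⟨ cong₂ (λ k l → A 0F k ℤ.+ A (suc i) (σ ⟨$⟩ʳ l))
           (transpose-matchˡ (suc i) (suc j)) (transpose-matchʳ 0F (suc i)) ⟩
    A 0F (suc j) ℤ.+ A (suc i) 0F ∎
    where
    open ≡-Reasoning
    σ τ : Permutation′ (suc n)
    σ = transpose (suc i) (suc j)
    τ = transpose 0F (suc i)

  -- Anchored at the corner entry, the identity says that any row differs from row 0 by a constant,
  -- which is what separates `A` into row and column parts.
  exchange : ∀ i j → A 0F 0F ℤ.+ A i j ≡ A 0F j ℤ.+ A i 0F
  exchange zero    j       = ℤₚ.+-comm (A 0F 0F) (A 0F j)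
  exchange (suc i) zero    = refl
  exchange (suc i) (suc j) = exchange-suc i j

argmin : (f : Fin (suc n) → ℕ) → ∃[ m ] (∀ j → f m ≤ f j)
argmin {zero}  f = zero , λ { zero → ℕₚ.≤-refl }
argmin {suc n} f with argmin (f ∘ suc)
... | m , min with ℕₚ.≤-total (f 0F) (f (suc m))
...   | inj₁ le = zero , λ { zero → ℕₚ.≤-refl ; (suc j) → ℕₚ.≤-trans le (min j) }
...   | inj₂ ge = suc m , λ { zero → ge ; (suc j) → min j }

-- Take `c` to be row 0 lowered by its minimum, attained at column `m`, so that `c` vanishes there;
-- column 0 then forces `r`.
additive-decomposition : (a : Fin (suc n) → Fin (suc n) → ℕ) →
  (∀ i j → a 0F 0F + a i j ≡ a 0F j + a i 0F) →
  ∃[ r ] ∃[ c ] (HasZero {suc n} c × (∀ i j → lookup r i + lookup c j ≡ a i j))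
additive-decomposition {n} a exch with argmin (a 0F)
... | m , min = tabulate r , tabulate c ,
  lookup⇒HasZero (tabulate c) m (trans (lookup∘tabulate c m) (ℕₚ.n∸n≡0 (a 0F m))) ,
  λ i j → trans (cong₂ _+_ (lookup∘tabulate r i) (lookup∘tabulate c j)) (r+c i j)
  where
  c r : Fin (suc n) → ℕ
  c j = a 0F j ∸ a 0F m
  r i = a i 0F ∸ c 0F

  c+min : ∀ j → c j + a 0F m ≡ a 0F j
  c+min j = ℕₚ.m∸n+n≡m (min j)

  -- Keeps the subtraction in `r i` from truncating: by the exchange identity in column `m`, the
  -- difference is the entry `a i m`.
  c₀≤ : ∀ i → c 0F ≤ a i 0F
  c₀≤ i = ℕₚ.+-cancelˡ-≤ (a 0F m) _ _ (begin
    a 0F m + c 0F    ≡⟨ ℕₚ.+-comm (a 0F m) (c 0F) ⟩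
    c 0F + a 0F m    ≡⟨ c+min 0F ⟩
    a 0F 0F          ≤⟨ ℕₚ.m≤m+n _ _ ⟩
    a 0F 0F + a i m  ≡⟨ exch i m ⟩
    a 0F m + a i 0F  ∎)
    where open ℕₚ.≤-Reasoning

  r+c : ∀ i j → r i + c j ≡ a i j
  r+c i j = ℕₚ.+-cancelˡ-≡ (a 0F 0F) _ _ (begin
    -- Adding `a 0F 0F`, which is `c 0F` plus the minimum, undoes both truncated subtractions at
    -- once.
    a 0F 0F + (r i + c j)           ≡⟨ cong (_+ (r i + c j)) (c+min 0F) ⟨
    c 0F + a 0F m + (r i + c j)     ≡⟨ regroup (c 0F) (a 0F m) (r i) (c j) ⟩
    (c j + a 0F m) + (r i + c 0F)   ≡⟨ cong₂ _+_ (c+min j) (ℕₚ.m∸n+n≡m (c₀≤ i)) ⟩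
    a 0F j + a i 0F                 ≡⟨ exch i j ⟨
    a 0F 0F + a i j                 ∎)
    where
    open ≡-Reasoning
    regroup : ∀ x y z w → x + y + (z + w) ≡ (w + y) + (z + x)
    regroup = ℕSolver.solve-∀

-- The bijection with G-matrices and the final count

normalPairs↔GMatrices : ∀ n N → Inverse (setoid (NormalPair (suc n) (suc n) N)) (GMatrices (suc n) N)
normalPairs↔GMatrices n N = Bijection⇒Inverse (record
  { to        = to
  ; cong      = λ { refl _ _ → refl }
  ; bijective = (λ {x} {y} → injective x y) ,
                (λ y → proj₁ (surjective y) , λ { refl → proj₂ (surjective y) })
  })
  where
  to : NormalPair (suc n) (suc n) N → Σ (Matrix (suc n)) (IsGMatrix (suc n) N)
  to ((r , c) , z , e) = sumMatrix r c , sumMatrix-isGMatrix r c e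

  injective : ∀ x y → (∀ i j → proj₁ (to x) i j ≡ proj₁ (to y) i j) → x ≡ y
  injective ((r , c) , z , _) ((r′ , c′) , z′ , _) eq with sumMatrix-injective r c r′ c′ z z′ eq
  ... | r≡r′ , c≡c′ = NormalPair-≡ (cong₂ _,_ r≡r′ c≡c′)

  surjective : ∀ y → ∃[ x ] (∀ i j → proj₁ (to x) i j ≡ proj₁ y i j)
  surjective (A , isG)
    -- Nonnegative entries equal their absolute values, which moves the exchange identity to the
    -- natural numbers.
    with additive-decomposition (λ i j → ∣ A i j ∣) (λ i j → +-injective (begin
      + ∣ A 0F 0F ∣ ℤ.+ + ∣ A i j ∣ ≡⟨ cong₂ ℤ._+_ (abs 0F 0F) (abs i j) ⟩
      A 0F 0F ℤ.+ A i j             ≡⟨ exchange isG i j ⟩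
      A 0F j ℤ.+ A i 0F             ≡⟨ cong₂ ℤ._+_ (abs 0F j) (abs i 0F) ⟨
      + ∣ A 0F j ∣ ℤ.+ + ∣ A i 0F ∣ ∎))
    where
    open ≡-Reasoning
    abs : ∀ i j → + ∣ A i j ∣ ≡ A i j
    abs i j = 0≤i⇒+∣i∣≡i (IsGMatrix.nonneg isG i j)
  ... | r , c , z , r+c = ((r , c) , z , +-injective sum≡N) , entries
    where
    entries : ∀ i j → sumMatrix r c i j ≡ A i j
    entries i j = trans (cong +_ (r+c i j)) (0≤i⇒+∣i∣≡i (IsGMatrix.nonneg isG i j))
    -- The identity permutation alone recovers the total `N`.
    sum≡N : + (sum r + sum c) ≡ + N
    sum≡N = trans (sym (sumMatrix-value r c id))
      (trans (sum-cong-≗ {suc n} λ i → entries i i) (IsGMatrix.value isG id))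

-- For `m = 0` and positive `N` the count is 0 while the truncated binomial is 1, whence the
-- hypothesis.
compositionCount-pred : ∀ m N → 0 < m → compositionCount m N ≡ (N + m ∸ 1) C (m ∸ 1)
compositionCount-pred (suc m) N _ =
  trans (compositionCount-suc m N) (cong (λ k → (k ∸ 1) C m) (sym (ℕₚ.+-suc N m)))

mainTheorem3 : (d : ℕ) → d ≥ 1 → (N : ℕ) →
    ∃[ g ] (HasCardinality (GMatrices d N) g ×
    + g ≡ ∑[ i < d ] (let k = suc (toℕ i) in
    (-1ℤ ℤ.^ (k ∸ 1)) ℤ.* (+ (d C k)) ℤ.* (+ ((N + 2 * d ∸ k ∸ 1) C (2 * d ∸ k ∸ 1)))))
mainTheorem3 d@(suc n) _ N =
  normalPairCount d d N ,
  inverse (normalPairs d d N) (normalPairs↔GMatrices n N) ,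
  trans (normalPairCount-alternatingSum d d N) (alternatingSum-cong d (λ i → cong +_ ∘ count i))
  where
  open ≡-Reasoning
  count : ∀ i → i < d →
    compositionCount (d + d ∸ suc i) N ≡ (N + 2 * d ∸ suc i ∸ 1) C (2 * d ∸ suc i ∸ 1)
  count i i<d = begin
    compositionCount (d + d ∸ suc i) N
      -- `2 * d` unfolds to `d + (d + 0)`.
      ≡⟨ cong (λ e → compositionCount (d + e ∸ suc i) N) (ℕₚ.+-identityʳ d) ⟨
    compositionCount (2 * d ∸ suc i) N
      ≡⟨ compositionCount-pred (2 * d ∸ suc i) N (ℕₚ.m<n⇒0<n∸m i+1<2d) ⟩
    (N + (2 * d ∸ suc i) ∸ 1) C (2 * d ∸ suc i ∸ 1)
      ≡⟨ cong (λ e → (e ∸ 1) C (2 * d ∸ suc i ∸ 1)) (ℕₚ.+-∸-assoc N (ℕₚ.<⇒≤ i+1<2d)) ⟨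
    (N + 2 * d ∸ suc i ∸ 1) C (2 * d ∸ suc i ∸ 1) ∎
    where
    -- Strictness keeps the length `2 * d ∸ suc i` positive, as `compositionCount-pred` demands.
    i+1<2d : suc i < 2 * d
    i+1<2d = ℕₚ.≤-<-trans i<d (ℕₚ.m<m+n d (s≤s z≤n))
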